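{- Let $\mathsf{L}$ be a logic, $\mathcal{C}$ a class of $\mathsf{L}$-models, and $\Theta=(\Theta_M)_{M\in\mathcal{C}}$ an $(\mathsf{L},\mathcal{C})$-pair. Then for every fragment $\mathsf{L}'$ of $\mathsf{L}$ and every $\mathcal{C}$-sample $\mathcal{S}=(\mathcal{P},\mathcal{N})$, the sample $\mathcal{S}$ is $\mathsf{L}'$-separable if and only if there is an $\mathcal{S}$-separating $\mathsf{L}'$-formula $\varphi$ with $\mathsf{sz}(\varphi)\le n^{\mathcal{S}}_{\Theta}:=\sum_{\tau\in\mathcal{T}}\prod_{M\in\mathcal{P}\cup\mathcal{N}}|\mathsf{SEM}_M(\tau)|$.
   Context: A logic $\mathsf{L}$ is given by a syntax $(\mathcal{T},\mathcal{T}_f,\mathsf{Op},(\tau_o)_{o\in\mathsf{Op}},T)$: $\mathcal{T}$ is a non-empty finite set of types, $\emptyset\neq\mathcal{T}_f\subseteq\mathcal{T}$ is the set of final types, $\mathsf{Op}=\mathsf{Op}_0\uplus\mathsf{Op}_1\uplus\mathsf{Op}_2$ is a set of operators ($\mathsf{Op}_i$ = operators of arity $i$) with $\mathsf{Op}_0\neq\emptyset$; each operator $o$ has a type $\tau_o\in\mathcal{T}$, and for each argument position $i$ of $o$ a set $T(o,i)\subseteq\mathcal{T}$ of allowed argument types. The sets $\mathsf{Fm}_{\mathsf{L}}(\tau)$ of $\mathsf{L}$-formulas of type $\tau$ are defined inductively: each $o\in\mathsf{Op}_0$ is a formula of type $\tau_o$; if $o\in\mathsf{Op}_1$ and $\varphi_1$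 has a type in $T(o,1)$ then $o(\varphi_1)$ has type $\tau_o$; if $o\in\mathsf{Op}_2$ and $\varphi_i$ has a type in $T(o,i)$ ($i=1,2$) then $o(\varphi_1,\varphi_2)$ has type $\tau_o$. For $X\subseteq\mathcal{T}$, $\mathsf{Fm}_{\mathsf{L}}(X)=\bigcup_{\tau\in X}\mathsf{Fm}_{\mathsf{L}}(\tau)$; $\mathsf{Fm}_{\mathsf{L}}=\mathsf{Fm}_{\mathsf{L}}(\mathcal{T})$ and the final formulas are $\mathsf{Fm}^f_{\mathsf{L}}=\mathsf{Fm}_{\mathsf{L}}(\mathcal{T}_f)$. A fragment $\mathsf{L}'$ of $\mathsf{L}$ is a logic with the same syntax except that its operator set is some $\mathsf{Op}'\subseteq\mathsf{Op}$. The set $\mathsf{Sub}(\varphi)$ of subformulas is defined inductively ($\mathsf{Sub}(o)=\{o\}$, $\mathsf{Sub}(o(\varphi_1))=\{o(\varphi_1)\}\cup\mathsf{Sub}(\varphi_1)$, $\mathsf{Sub}(o(\varphi_1,\varphi_2))=\{o(\varphi_1,\varphi_2)\}\cup\mathsf{Sub}(\varphi_1)\cup\mathsf{Sub}(\varphi_2)$), and the size is $\mathsf{sz}(\varphi)=|\mathsf{Sub}(\varphi)|$ (number of distinct subformulas). An $\mathsf{L}$-model is a structure $M$ together with a satisfaction relation $M\models\varphi$ for final $\mathsf{L}$-formulas $\varphi$; a class of $\mathsf{L}$-models is a set of $\mathsf{L}$-models. A $\mathcal{C}$-sample is a pair $(\mathcal{P},\mathcal{N})$ of finite subsets of $\mathcal{C}$.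 A final $\mathsf{L}'$-formula $\varphi$ is $\mathcal{S}$-separating if $M\models\varphi$ for all $M\in\mathcal{P}$ and $M\not\models\varphi$ for all $M\in\mathcal{N}$; $\mathcal{S}$ is $\mathsf{L}'$-separable if such a formula exists. For an $\mathsf{L}$-model $M$, an $(\mathsf{L},M)$-pair $(\mathsf{SEM}_M,\mathsf{sem}_M)$ consists of a finite set $\mathsf{SEM}_M=\bigcup_{\tau\in\mathcal{T}}\mathsf{SEM}_M(\tau)$ with the $\mathsf{SEM}_M(\tau)$ pairwise disjoint, and a map $\mathsf{sem}_M:\mathsf{Fm}_{\mathsf{L}}\to\mathsf{SEM}_M$ with $\mathsf{sem}_M(\varphi)\in\mathsf{SEM}_M(\tau)$ whenever $\varphi\in\mathsf{Fm}_{\mathsf{L}}(\tau)$; write $\mathsf{SEM}_M(X)=\bigcup_{\tau\in X}\mathsf{SEM}_M(\tau)$. It captures the $\mathsf{L}$-semantics if for every $\tau\in\mathcal{T}$ and all final $\varphi,\varphi'$ of type $\tau$, $\mathsf{sem}_M(\varphi)=\mathsf{sem}_M(\varphi')$ implies ($M\models\varphi$ iff $M\models\varphi'$). It satisfies the inductive property if for every $o\in\mathsf{Op}_1$ there is a function $\mathsf{sem}^o_M:\mathsf{SEM}_M(T(o,1))\to\mathsf{SEM}_M(\tau_o)$ with $\mathsf{sem}_M(o(\varphi_1))=\mathsf{sem}^o_M(\mathsf{sem}_M(\varphi_1))$ for all $\varphi_1\in\mathsf{Fm}_{\mathsf{L}}(T(o,1))$, and for every $o\in\mathsf{Op}_2$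 there is a function $\mathsf{sem}^o_M:\mathsf{SEM}_M(T(o,1))\times\mathsf{SEM}_M(T(o,2))\to\mathsf{SEM}_M(\tau_o)$ with $\mathsf{sem}_M(o(\varphi_1,\varphi_2))=\mathsf{sem}^o_M(\mathsf{sem}_M(\varphi_1),\mathsf{sem}_M(\varphi_2))$ for all $\varphi_i\in\mathsf{Fm}_{\mathsf{L}}(T(o,i))$. An $(\mathsf{L},\mathcal{C})$-pair is a family $\Theta=(\Theta_M)_{M\in\mathcal{C}}$ where each $\Theta_M=(\mathsf{SEM}_M,\mathsf{sem}_M)$ is an $(\mathsf{L},M)$-pair that both captures the $\mathsf{L}$-semantics and satisfies the inductive property. -}

module Defs where

open import Data.Fin using (Fin; toℕ)
open import Data.Fin.Patterns using (0F; 1F; 2F)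
open import Data.List using (List; length; map; product; sum)
open import Data.List.Membership.Propositional using (_∈_)
open import Data.List.Relation.Unary.Unique.Propositional using (Unique)
open import Data.Nat using (ℕ)
open import Data.Product using (Σ; Σ-syntax; ∃; _×_)
open import Data.Refinement using (Refinement; value)
open import Data.Unit using (tt)
open import Function using (_∘_; _⇔_)
open import Level using (Level; 0ℓ; _⊔_) renaming (suc to lsuc)
open import Relation.Binary.PropositionalEquality using (_≡_)
open import Relation.Nullary using (¬_)
open import Relation.Unary using (Pred; Satisfiable; _∪_; ｛_｝; U)

private
  variable
    a f g i m p s x ℓ : Level

------------------------------------------------------------------------
-- Finite subsets and cardinality

record Finite {A : Set a} (X : Pred A x) : Set (a ⊔ x) where
  field
    elements : List A
    unique   : Unique elements
    exact    : ∀ y → y ∈ elements ⇔ X y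

open Finite public using (elements)

-- The cardinality does not depend on the enumeration.
card : {A : Set a} {X : Pred A x} → Finite X → ℕ
card = length ∘ elements

------------------------------------------------------------------------
-- ⋃ X F is the union of the sets F τ over τ ∈ X, for a family whose
-- members at different indices are distinct. The proof of τ ∈ X is
-- irrelevant, so X really acts as a subset.

record ⋃ {I : Set i} (X : Pred I x) (F : I → Set f) : Set (i ⊔ x ⊔ f) where
  constructor ⟨_,_,_⟩
  field
    index  : I
    .index∈ : X index
    item   : F index

open ⋃ public using (index; item)

map⋃ : {I : Set i} {X : Pred I x} {F : I → Set f} {G : I → Set g} →
       (∀ {τ} → F τ → G τ) → ⋃ X F → ⋃ X G
map⋃ h ⟨ τ , τ∈X , y ⟩ = ⟨ τ , τ∈X , h y ⟩

------------------------------------------------------------------------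
-- Logics and formulas

-- Op k is the set of operators of arity k; argument positions are
-- numbered from 0. Non-emptiness of 𝒯 follows from that of 𝒯f.
record Logic (ℓ : Level) : Set (lsuc ℓ) where
  field
    𝒯            : Set
    𝒯-finite     : Finite {A = 𝒯} U
    𝒯f           : Pred 𝒯 0ℓ
    𝒯f-nonempty  : Satisfiable 𝒯f
    Op           : Fin 3 → Set ℓ
    Op₀-nonempty : Op 0F
    typ          : ∀ {k} → Op k → 𝒯
    T            : ∀ {k} → Op k → Fin (toℕ k) → Pred 𝒯 0ℓ

module _ (L : Logic ℓ) where
  open Logic L

  -- A formula has exactly one type, that of its main operator, so the
  -- sets of formulas of a given type form a disjoint family.
  data Fm : 𝒯 → Set ℓ where
    op₀ : (o : Op 0F) → Fm (typ o)
    op₁ : (o : Op 1F) → ⋃ (T o 0F) Fm → Fm (typ o)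
    op₂ : (o : Op 2F) → ⋃ (T o 0F) Fm → ⋃ (T o 1F) Fm → Fm (typ o)

  Fm[_] : Pred 𝒯 0ℓ → Set ℓ
  Fm[ X ] = ⋃ X Fm

  Formula : Set ℓ
  Formula = Fm[ U ]

  FinalFormula : Set ℓ
  FinalFormula = Fm[ 𝒯f ]

module _ {L : Logic ℓ} where
  open Logic L

  untyped : ∀ {τ} → Fm L τ → Formula L
  untyped {τ} φ = ⟨ τ , tt , φ ⟩

  Sub : ∀ {τ} → Fm L τ → Pred (Formula L) ℓ
  Sub (op₀ o) = ｛ untyped (op₀ o) ｝
  Sub (op₁ o φ₁@(⟨ _ , _ , ψ₁ ⟩)) = ｛ untyped (op₁ o φ₁) ｝ ∪ Sub ψ₁
  Sub (op₂ o φ₁@(⟨ _ , _ , ψ₁ ⟩) φ₂@(⟨ _ , _ , ψ₂ ⟩)) =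
    ｛ untyped (op₂ o φ₁ φ₂) ｝ ∪ (Sub ψ₁ ∪ Sub ψ₂)

  -- Size as a relation: without decidable equality of operators,
  -- |Sub φ| is not a computable function of φ.
  infix 4 sz_≡_
  sz_≡_ : ∀ {τ} → Fm L τ → ℕ → Set ℓ
  sz φ ≡ k = Σ[ e ∈ Finite (Sub φ) ] card e ≡ k

------------------------------------------------------------------------
-- Fragments

record Fragment (L : Logic ℓ) : Set (lsuc ℓ) where
  open Logic L
  field
    Op′           : ∀ {k} → Pred (Op k) ℓ
    Op′₀-nonempty : Refinement (Op 0F) Op′

  logic : Logic ℓ
  logic = record
    { 𝒯            = 𝒯
    ; 𝒯-finite     = 𝒯-finite
    ; 𝒯f           = 𝒯f
    ; 𝒯f-nonempty  = 𝒯f-nonempty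
    ; Op           = λ k → Refinement (Op k) Op′
    ; Op₀-nonempty = Op′₀-nonempty
    ; typ          = typ ∘ value
    ; T            = T ∘ value
    }

  embed : ∀ {τ} → Fm logic τ → Fm L τ
  embed (op₀ o) = op₀ (value o)
  embed (op₁ o ⟨ _ , p , φ ⟩) = op₁ (value o) ⟨ _ , p , embed φ ⟩
  embed (op₂ o ⟨ _ , p , φ ⟩ ⟨ _ , q , ψ ⟩) =
    op₂ (value o) ⟨ _ , p , embed φ ⟩ ⟨ _ , q , embed ψ ⟩

------------------------------------------------------------------------
-- Models, samples, separation

record ModelClass (L : Logic ℓ) (m s : Level) : Set (ℓ ⊔ lsuc (m ⊔ s)) where
  infix 4 _⊨_
  field
    Model : Set m
    _⊨_   : Model → FinalFormula L → Set s

-- The enumeration of pos ∪ neg would be computable from the other two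
-- only if equality of models were decidable; classically it always exists.
record Sample {L : Logic ℓ} (𝒞 : ModelClass L m s) (p : Level) :
              Set (m ⊔ lsuc p) where
  open ModelClass 𝒞
  field
    pos neg    : Pred Model p
    pos-finite : Finite pos
    neg-finite : Finite neg
    all-finite : Finite (pos ∪ neg)

module _ {L : Logic ℓ} {𝒞 : ModelClass L m s}
         (L′ : Fragment L) (S : Sample 𝒞 p) where
  open ModelClass 𝒞
  open Fragment L′
  open Sample S

  Separating : Pred (FinalFormula logic) (m ⊔ s ⊔ p)
  Separating φ = (∀ M → pos M → M ⊨ map⋃ embed φ)
               × (∀ M → neg M → ¬ (M ⊨ map⋃ embed φ))

  Separable : Set (ℓ ⊔ m ⊔ s ⊔ p)
  Separable = ∃ Separating

------------------------------------------------------------------------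
-- Semantic pairs

-- A family indexed by types encodes pairwise disjoint sets SEM τ.
record SemPair (L : Logic ℓ) : Set (lsuc 0ℓ ⊔ ℓ) where
  open Logic L
  field
    SEM        : 𝒯 → Set
    SEM-finite : ∀ τ → Finite {A = SEM τ} U
    sem        : ∀ {τ} → Fm L τ → SEM τ

  SEM[_] : Pred 𝒯 0ℓ → Set
  SEM[ X ] = ⋃ X SEM

  sem[_] : (X : Pred 𝒯 0ℓ) → Fm[_] L X → SEM[ X ]
  sem[ X ] = map⋃ sem

  Captures : (FinalFormula L → Set s) → Set (ℓ ⊔ s)
  Captures M⊨_ = ∀ τ .(τ∈ : 𝒯f τ) (φ φ′ : Fm L τ) → sem φ ≡ sem φ′ →
                 M⊨ ⟨ τ , τ∈ , φ ⟩ ⇔ M⊨ ⟨ τ , τ∈ , φ′ ⟩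

  Inductive : Set ℓ
  Inductive =
    (∀ (o : Op 1F) →
       Σ[ semᵒ ∈ (SEM[ T o 0F ] → SEM (typ o)) ]
       ∀ φ₁ → sem (op₁ o φ₁) ≡ semᵒ (sem[ T o 0F ] φ₁))
    ×
    (∀ (o : Op 2F) →
       Σ[ semᵒ ∈ (SEM[ T o 0F ] → SEM[ T o 1F ] → SEM (typ o)) ]
       ∀ φ₁ φ₂ → sem (op₂ o φ₁ φ₂) ≡
                 semᵒ (sem[ T o 0F ] φ₁) (sem[ T o 1F ] φ₂))

record ClassPair {L : Logic ℓ} (𝒞 : ModelClass L m s) :
                 Set (lsuc 0ℓ ⊔ ℓ ⊔ m ⊔ s) where
  open ModelClass 𝒞
  field
    pair        : Model → SemPair L
    isCapturing : ∀ M → SemPair.Captures (pair M) (M ⊨_)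
    isInductive : ∀ M → SemPair.Inductive (pair M)

module _ {L : Logic ℓ} {𝒞 : ModelClass L m s}
         (Θ : ClassPair 𝒞) (S : Sample 𝒞 p) where
  open Logic L
  open ModelClass 𝒞
  open ClassPair Θ
  open Sample S

  ∣SEM_∣ : Model → 𝒯 → ℕ
  ∣SEM M ∣ τ = card (SemPair.SEM-finite (pair M) τ)

  bound : ℕ
  bound = sum (map (λ τ → product (map (λ M → ∣SEM M ∣ τ)
                                       (elements all-finite)))
                   (elements 𝒯-finite))

-- Formulas of the same type with the same semantic value in every model of the
-- sample are interchangeable. Rebuilding a formula bottom-up, with one fixed
-- representative per class, gives an equivalent formula whose distinct
-- subformulas lie in distinct classes, and there are at most n^S_Θ classes.

module Submission where

open import Defs
open import Data.Fin using (Fin; zero; suc; _↑ˡ_; _↑ʳ_; combine; splitAt)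
open import Data.Fin.Patterns using (0F; 1F; 2F)
open import Data.Fin.Properties
  using (_≟_; splitAt-↑ˡ; splitAt-↑ʳ; ↑ˡ-injective; ↑ʳ-injective;
         combine-injective; injective⇒≤; ≡-decSetoid)
open import Data.List
  using (List; []; _∷_; _++_; map; length; lookup; deduplicate)
open import Data.List.Membership.Propositional using (_∈_; find; lose)
open import Data.List.Membership.Propositional.Properties
  using (∈-++⁺ˡ; ∈-++⁺ʳ; ∈-++⁻; ∈-lookup)
import Data.List.Membership.Setoid.Properties as Membershipₛ
open import Data.List.Relation.Binary.Subset.Propositional using (_⊆_)
open import Data.List.Relation.Unary.All as All using ()
open import Data.List.Relation.Unary.AllPairs as AllPairs using (_∷_)
open import Data.List.Relation.Unary.Any as Any using (here; there; any?)
open import Data.List.Relation.Unary.Unique.DecSetoid.Properties using (deduplicate-!)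
import Data.List.Relation.Unary.Unique.Setoid as Uniqueₛ
open import Data.Nat using (ℕ; _≤_)
open import Data.Nat.ListAction using (sum; product)
open import Data.Product using (Σ; Σ-syntax; ∃-syntax; _×_; _,_; proj₁; proj₂)
open import Data.Product.Properties.WithK using (,-injectiveʳ)
open import Data.Refinement using (value)
open import Data.Sum using (_⊎_; inj₁; inj₂)
open import Data.Unit using (tt)
open import Function using (_⇔_; mk⇔; _∘_; Equivalence)
open import Level using (Level; _⊔_)
open import Relation.Binary using (Setoid; DecSetoid)
import Relation.Binary.Construct.On as On
open import Relation.Binary.PropositionalEquality
  using (_≡_; refl; sym; trans; cong; cong₂; setoid)
open import Relation.Nullary using (yes; no; contradiction)
open import Relation.Unary using (Pred; U)

private
  variable
    a ℓ m s p x : Level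
    A : Set a

-- Numbering finite sums, products and sets by elements of `Fin`.

lookup-injective : (S : Setoid a ℓ) → let open Setoid S renaming (Carrier to C) in
                   {xs : List C} → Uniqueₛ.Unique S xs →
                   ∀ i j → lookup xs i ≈ lookup xs j → i ≡ j
lookup-injective S (_  ∷ _)  zero    zero    _  = refl
lookup-injective S (px ∷ _)  zero    (suc j) eq = contradiction eq (All.lookup px (∈-lookup j))
lookup-injective S (px ∷ _)  (suc i) zero    eq =
  contradiction (Setoid.sym S eq) (All.lookup px (∈-lookup i))
lookup-injective S (_  ∷ xs) (suc i) (suc j) eq = cong suc (lookup-injective S xs i j eq)

module _ (f : A → ℕ) where

  inSum : ∀ {x xs} → x ∈ xs → Fin (f x) → Fin (sum (map f xs))
  inSum (here refl) i = i ↑ˡ _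
  inSum (there x∈)  i = f _ ↑ʳ inSum x∈ i

  ↑ˡ≢↑ʳ : ∀ {k l} (i : Fin k) (j : Fin l) {C : Set} → i ↑ˡ l ≡ k ↑ʳ j → C
  ↑ˡ≢↑ʳ {k} {l} i j eq
    with () ← trans (sym (splitAt-↑ˡ k i l)) (trans (cong (splitAt k) eq) (splitAt-↑ʳ k l j))

  -- Different positions in `xs` occupy disjoint blocks. An equality of dependent pairs is needed
  -- since the type of `i` varies with `x`.
  inSum-injective : ∀ {x y xs} (x∈ : x ∈ xs) (y∈ : y ∈ xs) {i j} →
                    inSum x∈ i ≡ inSum y∈ j → _≡_ {A = Σ A (Fin ∘ f)} (x , i) (y , j)
  inSum-injective (here refl) (here refl) {i} {j} eq = cong (_ ,_) (↑ˡ-injective _ i j eq)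
  inSum-injective (here refl) (there y∈)          eq = contradiction eq (↑ˡ≢↑ʳ _ _)
  inSum-injective (there x∈)  (here refl)         eq = contradiction (sym eq) (↑ˡ≢↑ʳ _ _)
  inSum-injective (there x∈)  (there y∈)          eq =
    inSum-injective x∈ y∈ (↑ʳ-injective (f _) _ _ eq)

  -- Mixed-radix numbering of the values that `g` takes along `xs`.
  tuple : (∀ x → Fin (f x)) → ∀ xs → Fin (product (map f xs))
  tuple g []       = zero
  tuple g (x ∷ xs) = combine (g x) (tuple g xs)

  tuple-cong : ∀ {g h} xs → (∀ {x} → x ∈ xs → g x ≡ h x) → tuple g xs ≡ tuple h xs
  tuple-cong []       eq = refl
  tuple-cong (x ∷ xs) eq = cong₂ combine (eq (here refl)) (tuple-cong xs (eq ∘ there))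

  tuple-injective : ∀ {g h xs} → tuple g xs ≡ tuple h xs →
                    ∀ {x} → x ∈ xs → g x ≡ h x
  tuple-injective {g} {h} {x ∷ xs} eq x∈
    with g≡h , eq′ ← combine-injective (g x) (tuple g xs) (h x) (tuple h xs) eq
    with x∈
  ... | here refl = g≡h
  ... | there x∈′ = tuple-injective eq′ x∈′

module _ (fin : Finite {A = A} U) where

  member : ∀ x → x ∈ elements fin
  member x = Equivalence.from (Finite.exact fin x) tt

  rank : A → Fin (card fin)
  rank x = Any.index (member x)

  rank-injective : ∀ {x y} → rank x ≡ rank y → x ≡ y
  rank-injective = Membershipₛ.index-injective (setoid A) (member _) (member _)

-- Listing subformulas, with repetitions.

module _ {L : Logic ℓ} where
  open Logic L

  subs : ∀ {τ} → Fm L τ → List (Formula L)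
  subs φ@(op₀ o)                             = untyped φ ∷ []
  subs φ@(op₁ o ⟨ _ , _ , φ₁ ⟩)                = untyped φ ∷ subs φ₁
  subs φ@(op₂ o ⟨ _ , _ , φ₁ ⟩ ⟨ _ , _ , φ₂ ⟩) = untyped φ ∷ subs φ₁ ++ subs φ₂

  ∈-subs⁺ : ∀ {τ} (φ : Fm L τ) {χ} → Sub φ χ → χ ∈ subs φ
  ∈-subs⁺ (op₀ o) refl = here refl
  ∈-subs⁺ (op₁ o ⟨ _ , _ , φ₁ ⟩) (inj₁ refl) = here refl
  ∈-subs⁺ (op₁ o ⟨ _ , _ , φ₁ ⟩) (inj₂ χ) = there (∈-subs⁺ φ₁ χ)
  ∈-subs⁺ (op₂ o ⟨ _ , _ , φ₁ ⟩ ⟨ _ , _ , φ₂ ⟩) (inj₁ refl) = here refl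
  ∈-subs⁺ (op₂ o ⟨ _ , _ , φ₁ ⟩ ⟨ _ , _ , φ₂ ⟩) (inj₂ (inj₁ χ)) =
    there (∈-++⁺ˡ (∈-subs⁺ φ₁ χ))
  ∈-subs⁺ (op₂ o ⟨ _ , _ , φ₁ ⟩ ⟨ _ , _ , φ₂ ⟩) (inj₂ (inj₂ χ)) =
    there (∈-++⁺ʳ (subs φ₁) (∈-subs⁺ φ₂ χ))

  ∈-subs⁻ : ∀ {τ} (φ : Fm L τ) {χ} → χ ∈ subs φ → Sub φ χ
  ∈-subs⁻ (op₀ o) (here refl) = refl
  ∈-subs⁻ (op₁ o ⟨ _ , _ , φ₁ ⟩) (here refl) = inj₁ refl
  ∈-subs⁻ (op₁ o ⟨ _ , _ , φ₁ ⟩) (there χ∈) = inj₂ (∈-subs⁻ φ₁ χ∈)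
  ∈-subs⁻ (op₂ o ⟨ _ , _ , φ₁ ⟩ ⟨ _ , _ , φ₂ ⟩) (here refl) = inj₁ refl
  ∈-subs⁻ (op₂ o ⟨ _ , _ , φ₁ ⟩ ⟨ _ , _ , φ₂ ⟩) (there χ∈) with ∈-++⁻ (subs φ₁) χ∈
  ... | inj₁ χ∈₁ = inj₂ (inj₁ (∈-subs⁻ φ₁ χ∈₁))
  ... | inj₂ χ∈₂ = inj₂ (inj₂ (∈-subs⁻ φ₂ χ∈₂))

-- Small representatives for an abstract code in `Fin n`.

module _ {L : Logic ℓ} {n : ℕ} (code : ∀ {τ} → Fm L τ → Fin n) where
  open Logic L

  InjectiveOn : Pred (Formula L) x → Set (ℓ ⊔ x)
  InjectiveOn P = ∀ {φ ψ} → P φ → P ψ → code (item φ) ≡ code (item ψ) → φ ≡ ψ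

  -- Formulas need not have decidable equality, but codes do. By injectivity, removing repeated
  -- codes from `subs φ` removes exactly the repeated formulas, and at most `n` codes remain.
  sz≤n : ∀ {τ} (φ : Fm L τ) → InjectiveOn (Sub φ) → ∃[ k ] ((sz φ ≡ k) × (k ≤ n))
  sz≤n φ inj = length reps , (finite , refl) ,
      injective⇒≤ (lookup-injective D.setoid unique′ _ _)
    where
    D = On.decSetoid (≡-decSetoid n) (λ (χ : Formula L) → code (item χ))
    module D = DecSetoid D
    reps = deduplicate D._≟_ (subs φ)
    unique′ = deduplicate-! D (subs φ)

    reps⇒Sub : ∀ {χ} → χ ∈ reps → Sub φ χ
    reps⇒Sub = ∈-subs⁻ φ ∘ Membershipₛ.∈-deduplicate⁻ (setoid _) D._≟_ (subs φ)

    Sub⇒reps : ∀ {χ} → Sub φ χ → χ ∈ reps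
    Sub⇒reps χ-sub
      -- Deduplication keeps some entry `ψ` with the code of the given subformula; injectivity
      -- identifies the two.
      with ψ , ψ∈ , eq ← find (Membershipₛ.∈-deduplicate⁺ D.setoid D._≟_
             (λ z≈y x≈y → trans x≈y (sym z≈y))
             (Any.map (cong (code ∘ item)) (∈-subs⁺ φ χ-sub)))
      with refl ← inj χ-sub (reps⇒Sub ψ∈) eq = ψ∈

    finite : Finite (Sub φ)
    finite = record
      { elements = reps
      ; unique   = AllPairs.map (_∘ cong (code ∘ item)) unique′
      ; exact    = λ _ → mk⇔ reps⇒Sub Sub⇒reps
      }

  -- The fixed representatives chosen so far. Closure places all subformulas of a member in the
  -- list, where codes are injective, so `sz≤n` applies to every member.
  record Library (lib : List (Formula L)) : Set ℓ where
    field
      closed    : ∀ {φ χ} → φ ∈ lib → Sub (item φ) χ → χ ∈ lib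
      injective : InjectiveOn (_∈ lib)

  open Library

  record Extension {τ} (lib : List (Formula L)) (φ : Fm L τ) : Set ℓ where
    field
      {extended} : List (Formula L)
      library    : Library extended
      extends    : lib ⊆ extended
      rep        : Fm L τ
      rep∈       : untyped rep ∈ extended
      same       : code rep ≡ code φ

  -- Equality of codes is assumed to be a congruence that determines types, so a stored formula can
  -- replace any argument with the same code.
  module _
    (code-typ : ∀ {σ τ} {φ : Fm L σ} {ψ : Fm L τ} → code φ ≡ code ψ → σ ≡ τ)
    (code-op₁ : ∀ (o : Op 1F) {τ} .(τ∈ : T o 0F τ) {φ ψ : Fm L τ} → code φ ≡ code ψ →
                code (op₁ o ⟨ τ , τ∈ , φ ⟩) ≡ code (op₁ o ⟨ τ , τ∈ , ψ ⟩))
    (code-op₂ : ∀ (o : Op 2F) {σ τ} .(σ∈ : T o 0F σ) .(τ∈ : T o 1F τ)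
                {φ₁ ψ₁ : Fm L σ} {φ₂ ψ₂ : Fm L τ} →
                code φ₁ ≡ code ψ₁ → code φ₂ ≡ code ψ₂ →
                code (op₂ o ⟨ σ , σ∈ , φ₁ ⟩ ⟨ τ , τ∈ , φ₂ ⟩) ≡
                code (op₂ o ⟨ σ , σ∈ , ψ₁ ⟩ ⟨ τ , τ∈ , ψ₂ ⟩))
    where

    -- If the code of `φ` is already taken, the stored formula represents it. Otherwise `φ` itself
    -- is added: its other subformulas are present, and its code is new.
    insert : ∀ {lib τ} → Library lib → (φ : Fm L τ) →
             (∀ {χ} → Sub φ χ → untyped φ ≡ χ ⊎ χ ∈ lib) → Extension lib φ
    insert {lib} libr φ φ-sub with any? (λ χ → code (item χ) ≟ code φ) lib
    ... | yes any with χ , χ∈ , eq ← find any with refl ← code-typ eq = record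
      { library = libr ; extends = λ ψ∈ → ψ∈ ; rep = item χ ; rep∈ = χ∈ ; same = eq }
    ... | no ¬any = record
      { library = record { closed = closed′ ; injective = injective′ }
      ; extends = there ; rep = φ ; rep∈ = here refl ; same = refl }
      where
      closed′ : ∀ {ψ χ} → ψ ∈ untyped φ ∷ lib → Sub (item ψ) χ → χ ∈ untyped φ ∷ lib
      closed′ (here refl) χ-sub with φ-sub χ-sub
      ... | inj₁ refl = here refl
      ... | inj₂ χ∈   = there χ∈
      closed′ (there ψ∈) χ-sub = there (closed libr ψ∈ χ-sub)

      injective′ : InjectiveOn (_∈ untyped φ ∷ lib)
      injective′ (here refl) (here refl) eq = refl
      injective′ (here refl) (there ψ∈)  eq = contradiction (lose ψ∈ (sym eq)) ¬any
      injective′ (there ψ∈)  (here refl) eq = contradiction (lose ψ∈ eq) ¬any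
      injective′ (there ψ∈)  (there χ∈)  eq = injective libr ψ∈ χ∈ eq

    -- Carries an extension for the rebuilt formula, over the enlarged library, back to the original
    -- formula and library.
    widen : ∀ {lib lib′ τ} {φ ψ : Fm L τ} → lib ⊆ lib′ → code φ ≡ code ψ →
            Extension lib′ φ → Extension lib ψ
    widen ⊆lib′ eq E = record
      { library = library ; extends = extends ∘ ⊆lib′ ; rep = rep ; rep∈ = rep∈
      ; same = trans same eq }
      where open Extension E

    -- Structural recursion: arguments are replaced by their representatives before the rebuilt
    -- formula is inserted.
    extend : ∀ {lib τ} → Library lib → (φ : Fm L τ) → Extension lib φ
    extend libr φ@(op₀ o) = insert libr φ inj₁
    extend libr (op₁ o ⟨ _ , τ∈ , φ ⟩) =
      widen extends (code-op₁ o τ∈ same)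
        (insert library (op₁ o ⟨ _ , τ∈ , rep ⟩) λ where
          (inj₁ eq) → inj₁ eq
          (inj₂ χ)  → inj₂ (closed library rep∈ χ))
      where open Extension (extend libr φ)
    extend libr (op₂ o ⟨ _ , σ∈ , φ ⟩ ⟨ _ , τ∈ , ψ ⟩) =
      -- The second argument extends the library produced by the first, so both representatives lie
      -- in one library.
      widen (E₂.extends ∘ E₁.extends) (code-op₂ o σ∈ τ∈ E₁.same E₂.same)
        (insert E₂.library (op₂ o ⟨ _ , σ∈ , E₁.rep ⟩ ⟨ _ , τ∈ , E₂.rep ⟩) λ where
          (inj₁ eq)       → inj₁ eq
          (inj₂ (inj₁ χ)) → inj₂ (closed E₂.library (E₂.extends E₁.rep∈) χ)
          (inj₂ (inj₂ χ)) → inj₂ (closed E₂.library E₂.rep∈ χ))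
      where
      module E₁ = Extension (extend libr φ)
      module E₂ = Extension (extend E₁.library ψ)

    emptyLibrary : Library []
    emptyLibrary = record { closed = λ () ; injective = λ () }

    smallRepresentative : ∀ {τ} (φ : Fm L τ) →
      Σ[ ψ ∈ Fm L τ ] (code ψ ≡ code φ) × ∃[ k ] ((sz ψ ≡ k) × (k ≤ n))
    smallRepresentative φ =
      rep , same ,
      sz≤n rep λ χ ψ → injective library (closed library rep∈ χ) (closed library rep∈ ψ)
      where
      open Extension (extend emptyLibrary φ)

-- The semantic code of a formula over a sample.

module _ {L : Logic ℓ} {𝒞 : ModelClass L m s}
         (Θ : ClassPair 𝒞) (L′ : Fragment L) (S : Sample 𝒞 p) where
  open Logic L
  open ModelClass 𝒞
  open ClassPair Θ
  open Fragment L′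
  open Sample S
  open module Sem M = SemPair (pair M) using (SEM-finite; sem)

  models : List Model
  models = elements all-finite

  infix 4 _≋_
  _≋_ : ∀ {τ} → Fm logic τ → Fm logic τ → Set m
  φ ≋ ψ = ∀ {M} → M ∈ models → sem M (embed φ) ≡ sem M (embed ψ)

  valueCode : ∀ {τ} → Fm logic τ → Fin (product (map (λ M → ∣SEM_∣ Θ S M τ) models))
  valueCode {τ} φ = tuple _ (λ M → rank (SEM-finite M τ) (sem M (embed φ))) models

  -- The type selects a summand of `bound`, and the values in the sample models select an element of
  -- the product there.
  semCode : ∀ {τ} → Fm logic τ → Fin (bound Θ S)
  semCode φ = inSum _ (member 𝒯-finite _) (valueCode φ)

  semCode-cong : ∀ {τ} {φ ψ : Fm logic τ} → φ ≋ ψ → semCode φ ≡ semCode ψ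
  semCode-cong φ≋ψ = cong (inSum _ (member 𝒯-finite _))
    (tuple-cong _ models λ M∈ → cong (rank (SEM-finite _ _)) (φ≋ψ M∈))

  semCode-typ : ∀ {σ τ} {φ : Fm logic σ} {ψ : Fm logic τ} → semCode φ ≡ semCode ψ → σ ≡ τ
  semCode-typ eq =
    cong proj₁ (inSum-injective _ (member 𝒯-finite _) (member 𝒯-finite _) eq)

  semCode-sem : ∀ {τ} {φ ψ : Fm logic τ} → semCode φ ≡ semCode ψ → φ ≋ ψ
  semCode-sem eq M∈ = rank-injective (SEM-finite _ _) (tuple-injective _
    -- Both formulas have type `τ`, so axiom K turns the equality of pairs into one of value codes.
    (,-injectiveʳ (inSum-injective _ (member 𝒯-finite _) (member 𝒯-finite _) eq)) M∈)

  -- By the inductive property, the value of the compound is a function of the value of its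
  -- argument.
  ≋-op₁ : ∀ (o : Logic.Op logic 1F) {τ} .(τ∈ : T (value o) 0F τ) {φ ψ : Fm logic τ} →
          φ ≋ ψ → op₁ o ⟨ τ , τ∈ , φ ⟩ ≋ op₁ o ⟨ τ , τ∈ , ψ ⟩
  ≋-op₁ o τ∈ φ≋ψ {M} M∈ with semᵒ , sem-op₁ ← proj₁ (isInductive M) (value o) =
    trans (sem-op₁ _) (trans (cong (λ v → semᵒ ⟨ _ , τ∈ , v ⟩) (φ≋ψ M∈)) (sym (sem-op₁ _)))

  ≋-op₂ : ∀ (o : Logic.Op logic 2F) {σ τ}
          .(σ∈ : T (value o) 0F σ) .(τ∈ : T (value o) 1F τ)
          {φ₁ ψ₁ : Fm logic σ} {φ₂ ψ₂ : Fm logic τ} → φ₁ ≋ ψ₁ → φ₂ ≋ ψ₂ →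
          op₂ o ⟨ σ , σ∈ , φ₁ ⟩ ⟨ τ , τ∈ , φ₂ ⟩ ≋ op₂ o ⟨ σ , σ∈ , ψ₁ ⟩ ⟨ τ , τ∈ , ψ₂ ⟩
  ≋-op₂ o σ∈ τ∈ φ₁≋ψ₁ φ₂≋ψ₂ {M} M∈
    with semᵒ , sem-op₂ ← proj₂ (isInductive M) (value o) =
    trans (sem-op₂ _ _)
      (trans (cong₂ (λ v w → semᵒ ⟨ _ , σ∈ , v ⟩ ⟨ _ , τ∈ , w ⟩) (φ₁≋ψ₁ M∈) (φ₂≋ψ₂ M∈))
             (sym (sem-op₂ _ _)))

  small : ∀ {τ} (φ : Fm logic τ) →
          Σ[ ψ ∈ Fm logic τ ] (ψ ≋ φ) × ∃[ k ] ((sz ψ ≡ k) × (k ≤ bound Θ S))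
  small φ
    with ψ , same , size ← smallRepresentative semCode semCode-typ
           -- Congruence of the code is obtained by passing to `≋`, applying the operator, and
           -- returning to codes.
           (λ o τ∈ {φ} {ψ} eq →
              semCode-cong {φ = op₁ o ⟨ _ , τ∈ , φ ⟩} {ψ = op₁ o ⟨ _ , τ∈ , ψ ⟩}
                (≋-op₁ o τ∈ {φ} {ψ} (semCode-sem eq)))
           (λ o σ∈ τ∈ {φ₁} {ψ₁} {φ₂} {ψ₂} eq₁ eq₂ →
              semCode-cong {φ = op₂ o ⟨ _ , σ∈ , φ₁ ⟩ ⟨ _ , τ∈ , φ₂ ⟩}
                           {ψ = op₂ o ⟨ _ , σ∈ , ψ₁ ⟩ ⟨ _ , τ∈ , ψ₂ ⟩}
                (≋-op₂ o σ∈ τ∈ {φ₁} {ψ₁} {φ₂} {ψ₂} (semCode-sem eq₁) (semCode-sem eq₂)))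
           φ = ψ , semCode-sem same , size

  ≋⇒⊨ : ∀ {τ} .(τ∈ : 𝒯f τ) {φ ψ : Fm logic τ} → φ ≋ ψ → ∀ {M} → M ∈ models →
        M ⊨ ⟨ τ , τ∈ , embed φ ⟩ ⇔ M ⊨ ⟨ τ , τ∈ , embed ψ ⟩
  ≋⇒⊨ τ∈ φ≋ψ M∈ = isCapturing _ _ τ∈ _ _ (φ≋ψ M∈)

  -- Capturing makes satisfaction agree on all models listed in `models`, which are exactly those in
  -- `pos` or `neg`.
  separating-resp-≋ : ∀ {τ} .(τ∈ : 𝒯f τ) {φ ψ : Fm logic τ} → φ ≋ ψ →
                      Separating L′ S ⟨ τ , τ∈ , ψ ⟩ → Separating L′ S ⟨ τ , τ∈ , φ ⟩
  separating-resp-≋ τ∈ {φ} {ψ} φ≋ψ (pos⊨ , neg⊭) =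
    (λ M M∈ → Equivalence.from (⊨⇔ (inj₁ M∈)) (pos⊨ M M∈)) ,
    (λ M M∈ → neg⊭ M M∈ ∘ Equivalence.to (⊨⇔ (inj₂ M∈)))
    where
    ⊨⇔ : ∀ {M} → pos M ⊎ neg M → M ⊨ ⟨ _ , τ∈ , embed φ ⟩ ⇔ M ⊨ ⟨ _ , τ∈ , embed ψ ⟩
    ⊨⇔ {M} M∈ = ≋⇒⊨ τ∈ φ≋ψ (Equivalence.from (Finite.exact all-finite M) M∈)

theorem1 : ∀ {ℓ m s p} (L : Logic ℓ) (𝒞 : ModelClass L m s)
    (Θ : ClassPair 𝒞) (L′ : Fragment L) (S : Sample 𝒞 p) →
    Separable L′ S ⇔
    (∃[ φ ] (Separating L′ S φ ×
    (∃[ k ] ((sz (item φ) ≡ k) × (k ≤ bound Θ S)))))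
theorem1 L 𝒞 Θ L′ S = mk⇔
  (λ (⟨ τ , τ∈ , φ ⟩ , sep) → let ψ , ψ≋φ , size = small Θ L′ S φ in
     -- The representative has the same type `τ`, so it is again final.
     ⟨ τ , τ∈ , ψ ⟩ , separating-resp-≋ Θ L′ S τ∈ ψ≋φ sep , size)
  (λ (φ , sep , _) → φ , sep)
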